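{- Let $n\ge 1$. The number of parking functions of $1,\ldots,n$ for which the first spot is lucky is \[ \sum_{i=1}^nq_n(i,1)=(n+1)^{n-1}. \]
   Context: There are $n$ spots labeled $1,\ldots,n$ in order along a one-way street, and $n$ cars entering one after another, car $i$ having preference $a_i\in\{1,\ldots,n\}$. Each car drives to its preferred spot and parks there if it is available; otherwise it moves forward and parks in the first available later spot, if any (if none, it fails to park). A parking function of $1,\ldots,n$ is a sequence of preferences $(a_1,\ldots,a_n)$ such that all $n$ cars are able to park. A car is lucky if it parks in its preferred spot; a spot is lucky if the car that parks in it prefers that spot. For $1\le i,j\le n$, $q_n(i,j)$ denotes the number of parking functions of $1,\ldots,n$ in which the $i$-th car prefers the $j$-th spot and the $i$-th car is lucky. -}

module Defs where

open import Data.Bool.Base using (true; false)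
open import Data.Fin.Base using (Fin; zero; suc)
open import Data.Fin.Properties using (any?) renaming (_≟_ to _≟ᶠ_)
open import Data.Fin.Subset using (Subset) renaming (⊥ to ∅)
open import Data.List.Base as List using (List)
open import Data.Maybe as Maybe using (Maybe; just; nothing; Is-just)
import Data.Maybe.Properties as Maybe
import Data.Maybe.Relation.Unary.Any as MaybeAny
open import Data.Nat.Base using (ℕ; zero; suc)
open import Data.Product.Base using (_×_; ∃-syntax)
open import Data.Unit.Base using (tt)
open import Data.Vec.Base using (Vec; []; _∷_; lookup; _[_]≔_)
open import Data.Vec.Relation.Unary.All using (All; all?)
open import Relation.Binary.PropositionalEquality using (_≡_)
open import Relation.Nullary.Decidable using (yes; _×-dec_)
open import Relation.Unary using (Pred; Decidable)
open import Level using (0ℓ)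

-- Spots and cars are both indexed by Fin n, so the paper's spot (or car) k is
-- the element of Fin n with value k - 1.

Preferences : ℕ → Set
Preferences n = Vec (Fin n) n

-- In the Subset of occupied spots, true means occupied.
firstAvailable : ∀ {n} → Subset n → Maybe (Fin n)
firstAvailable []            = nothing
firstAvailable (false ∷ occ) = just zero
firstAvailable (true  ∷ occ) = Maybe.map suc (firstAvailable occ)

-- The first available spot at or after the preferred one.
park : ∀ {n} → Subset n → Fin n → Maybe (Fin n)
park occ       zero    = firstAvailable occ
park (_ ∷ occ) (suc a) = Maybe.map suc (park occ a)

-- A car that fails to park leaves the street as it was.
occupy : ∀ {n} → Subset n → Maybe (Fin n) → Subset n
occupy occ (just s) = occ [ s ]≔ true
occupy occ nothing  = occ

parkAll : ∀ {n m} → Subset n → Vec (Fin n) m → Vec (Maybe (Fin n)) m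
parkAll occ []       = []
parkAll occ (a ∷ as) = park occ a ∷ parkAll (occupy occ (park occ a)) as

spots : ∀ {n} → Preferences n → Vec (Maybe (Fin n)) n
spots as = parkAll ∅ as

IsParkingFunction : ∀ {n} → Preferences n → Set
IsParkingFunction as = All Is-just (spots as)

LuckyCar : ∀ {n} → Preferences n → Fin n → Set
LuckyCar as i = lookup (spots as) i ≡ just (lookup as i)

-- At most one car parks in any given spot, so "the car that parks in j prefers
-- j" is rendered as the existence of a car that parks in j and prefers j.
LuckySpot : ∀ {n} → Preferences n → Fin n → Set
LuckySpot as j = ∃[ i ] (lookup (spots as) i ≡ just j × lookup as i ≡ j)

isParkingFunction? : ∀ {n} → Decidable (IsParkingFunction {n})
isParkingFunction? as = all? (MaybeAny.dec (λ _ → yes tt)) (spots as)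

luckyCar? : ∀ {n} (as : Preferences n) → Decidable (LuckyCar as)
luckyCar? as i = Maybe.≡-dec _≟ᶠ_ (lookup (spots as) i) (just (lookup as i))

luckySpot? : ∀ {n} (as : Preferences n) → Decidable (LuckySpot as)
luckySpot? as j =
  any? (λ i → Maybe.≡-dec _≟ᶠ_ (lookup (spots as) i) (just j) ×-dec (lookup as i ≟ᶠ j))

-- Every vector of length m over Fin n, listed exactly once.
allVecs : ∀ n m → List (Vec (Fin n) m)
allVecs n zero    = List.[ [] ]
allVecs n (suc m) = List.cartesianProductWith _∷_ (List.allFin n) (allVecs n m)

count : ∀ {n} (P : Pred (Preferences n) 0ℓ) → Decidable P → ℕ
count {n} P P? = List.length (List.filter P? (allVecs n n))

q : ∀ n → Fin n → Fin n → ℕ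
q n i j = count
  (λ as → IsParkingFunction as × lookup as i ≡ j × LuckyCar as i)
  (λ as → isParkingFunction? as ×-dec (lookup as i ≟ᶠ j) ×-dec luckyCar? as i)

#luckySpot : ∀ n → Fin n → ℕ
#luckySpot n j = count
  (λ as → IsParkingFunction as × LuckySpot as j)
  (λ as → isParkingFunction? as ×-dec luckySpot? as j)

{-# OPTIONS --safe #-}

-- Pollak's circle argument.  Add one spot in front of spot 1 and close the
-- street to a circle of n + 1 spots, so that every car parks.  A preference
-- sequence on the original street is a parking function exactly when, on the
-- circle, the added spot stays empty.  Of the (n + 1) ^ n circular sequences
-- each leaves exactly one spot empty, and by rotation every spot is left empty
-- equally often, so (n + 1) ^ (n - 1) sequences leave the added one empty.
-- In a parking function all spots are filled, and only a car preferring
-- spot 1 can fill it, so spot 1 is lucky thanks to exactly one car.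

module Submission where

open import Defs
open import Data.Bool.Base using (Bool; true; false; if_then_else_)
open import Data.Fin.Base using (Fin; zero; suc; fromℕ; fromℕ<; inject₁)
open import Data.Fin.Induction using (<-weakInduction)
open import Data.Fin.Properties using (_≟_)
open import Data.Fin.Subset using (Subset; ∁; ∣_∣) renaming (⊥ to ∅)
open import Data.Fin.Subset.Properties using (∣∁p∣≡n∸∣p∣; ∣⊥∣≡0)
open import Data.List.Base as List using (List; length; filter)
open import Data.List.Properties
  using (filter-++; filter-accept; filter-none; filter-reject; filter-≐; length-++)
import Data.List.Relation.Unary.All as ListAll
open import Data.Maybe as Maybe using (Maybe; just; nothing; Is-just; _<∣>_)
import Data.Maybe.Relation.Unary.Any as MaybeAny
open import Data.Nat.Base using (ℕ; zero; suc; _+_; _*_; _∸_; _^_; _≤_)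
open import Data.Nat.Properties
  using (+-*-semiring; +-comm; +-suc; *-assoc; *-cancelˡ-≡; *-identityʳ; suc-injective)
open import Algebra.Properties.Semiring.Sum +-*-semiring
  using (sum; sum-syntax; sum-cong-≗; sum-init-last; sum-replicate-zero; ∑-comm)
open import Data.Product using (_×_; _,_; proj₁; proj₂; ∃!)
open import Data.Unit.Base using (tt)
open import Data.Vec.Base using (Vec; []; _∷_; _∷ʳ_; lookup; _[_]≔_)
open import Data.Vec.Relation.Unary.All using (All; []; _∷_; all?)
open import Function.Base using (_∘_; const)
open import Level using (Level)
open import Relation.Binary.PropositionalEquality
open import Relation.Nullary.Decidable using (yes; no; _×-dec_)
open import Relation.Nullary.Negation using (contradiction)
open import Relation.Unary using (Pred; Decidable)

open ≡-Reasoning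

private
  variable
    a b p ℓ : Level
    A : Set a
    B : Set b
    k m n : ℕ

-- Finite sums and counting

sum-const : ∀ n c → sum {n} (const c) ≡ n * c
sum-const zero    c = refl
sum-const (suc n) c = cong (c +_) (sum-const n c)

sum-zero : {f : Fin n → ℕ} → (∀ i → f i ≡ 0) → sum f ≡ 0
sum-zero {n} f≗0 = trans (sum-cong-≗ f≗0) (sum-replicate-zero n)

sum-suc-at : {f g : Fin n → ℕ} (i : Fin n) → f i ≡ suc (g i) →
             (∀ j → i ≢ j → f j ≡ g j) → sum f ≡ suc (sum g)
sum-suc-at zero    fi≡ f≡g = cong₂ _+_ fi≡ (sum-cong-≗ (λ j → f≡g (suc j) λ ()))
sum-suc-at {g = g} (suc i) fi≡ f≡g = trans
  (cong₂ _+_ (f≡g zero λ ())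
             (sum-suc-at i fi≡ (λ j i≢j → f≡g (suc j) λ { refl → i≢j refl })))
  (+-suc (g zero) _)

-- Double counting: an entry satisfying `Q` is counted for exactly one `i`, any other entry for
-- none.
∑-length-filter :
  {P : Fin n → Pred A p} (P? : ∀ i → Decidable (P i)) {Q : Pred A ℓ} (Q? : Decidable Q) →
  (∀ {i x} → P i x → Q x) → (∀ {x} → Q x → ∃! _≡_ (λ i → P i x)) →
  ∀ xs → ∑[ i < n ] length (filter (P? i) xs) ≡ length (filter Q? xs)
∑-length-filter {n = n} P? Q? P⇒Q Q⇒∃!P List.[] = sum-replicate-zero n
∑-length-filter P? Q? P⇒Q Q⇒∃!P (x List.∷ xs) with Q? x
... | no ¬Qx = trans
  (sum-cong-≗ (λ i → cong length (filter-reject (P? i) (¬Qx ∘ P⇒Q))))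
  (∑-length-filter P? Q? P⇒Q Q⇒∃!P xs)
... | yes Qx with i , Pix , unique ← Q⇒∃!P Qx = trans
  (sum-suc-at i (cong length (filter-accept (P? i) Pix))
    (λ j i≢j → cong length (filter-reject (P? j) (i≢j ∘ unique))))
  (cong suc (∑-length-filter P? Q? P⇒Q Q⇒∃!P xs))

length-filter-map : {P : Pred B p} (P? : Decidable P) (f : A → B) (xs : List A) →
                    length (filter P? (List.map f xs)) ≡ length (filter (P? ∘ f) xs)
length-filter-map P? f List.[] = refl
length-filter-map P? f (x List.∷ xs) with P? (f x)
... | yes _ = cong suc (length-filter-map P? f xs)
... | no  _ = length-filter-map P? f xs

length-filter-allVecs :
  ∀ n m {P : Pred (Vec (Fin n) (suc m)) p} (P? : Decidable P) →
  length (filter P? (allVecs n (suc m))) ≡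
  ∑[ a < n ] length (filter (λ as → P? (a ∷ as)) (allVecs n m))
-- `List.allFin n` tabulates the identity; the induction passes to `f ∘ suc`, hence the arbitrary
-- `f`.
length-filter-allVecs n m P? = go (λ a → a)
  where
  go : (f : Fin k → Fin n) →
       length (filter P? (List.cartesianProductWith _∷_ (List.tabulate f) (allVecs n m))) ≡
       ∑[ i < k ] length (filter (λ as → P? (f i ∷ as)) (allVecs n m))
  go {zero}  f = refl
  go {suc k} f = begin
    length (filter P? (block List.++ rest))
      ≡⟨ cong length (filter-++ P? block rest) ⟩
    length (filter P? block List.++ filter P? rest)
      ≡⟨ length-++ (filter P? block) ⟩
    length (filter P? block) + length (filter P? rest)
      ≡⟨ cong₂ _+_ (length-filter-map P? (f zero ∷_) (allVecs n m)) (go (f ∘ suc)) ⟩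
    ∑[ i < suc k ] length (filter (λ as → P? (f i ∷ as)) (allVecs n m)) ∎
    where
    block = List.map (f zero ∷_) (allVecs n m)
    rest  = List.cartesianProductWith _∷_ (List.tabulate (f ∘ suc)) (allVecs n m)

-- Vacancies

firstAvailable-vacant : (occ : Subset n) {s : Fin n} →
                        firstAvailable occ ≡ just s → lookup occ s ≡ false
firstAvailable-vacant (false ∷ occ) refl = refl
firstAvailable-vacant (true  ∷ occ) eq with firstAvailable occ in eq′
firstAvailable-vacant (true  ∷ occ) refl | just s = firstAvailable-vacant occ eq′

firstAvailable-full : (occ : Subset n) → firstAvailable occ ≡ nothing → ∣ ∁ occ ∣ ≡ 0
firstAvailable-full []           _  = refl
firstAvailable-full (true ∷ occ) eq with firstAvailable occ in eq′
... | nothing = firstAvailable-full occ eq′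

park-vacant : (occ : Subset n) (a : Fin n) {s : Fin n} → park occ a ≡ just s → lookup occ s ≡ false
park-vacant occ       zero    eq = firstAvailable-vacant occ eq
park-vacant (_ ∷ occ) (suc a) eq with park occ a in eq′
park-vacant (_ ∷ occ) (suc a) refl | just s = park-vacant occ a eq′

vacancies-fill : (occ : Subset n) (s : Fin n) → lookup occ s ≡ false →
                 ∣ ∁ occ ∣ ≡ suc ∣ ∁ (occ [ s ]≔ true) ∣
vacancies-fill (false ∷ occ) zero    _  = refl
vacancies-fill (false ∷ occ) (suc s) eq = cong suc (vacancies-fill occ s eq)
vacancies-fill (true  ∷ occ) (suc s) eq = vacancies-fill occ s eq

vacancies-∅ : ∀ n → ∣ ∁ (∅ {n}) ∣ ≡ n
vacancies-∅ n = trans (∣∁p∣≡n∸∣p∣ (∅ {n})) (cong (n ∸_) (∣⊥∣≡0 n))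

∑-vacant : (occ : Subset n) → ∑[ e < n ] (if lookup occ e then 0 else 1) ≡ ∣ ∁ occ ∣
∑-vacant []            = refl
∑-vacant (false ∷ occ) = cong suc (∑-vacant occ)
∑-vacant (true  ∷ occ) = ∑-vacant occ

fill-occupied : (occ : Subset n) (s : Fin n) {e : Fin n} →
                lookup occ e ≡ true → lookup (occ [ s ]≔ true) e ≡ true
fill-occupied (_ ∷ occ) zero    {zero}  _  = refl
fill-occupied (_ ∷ occ) zero    {suc e} eq = eq
fill-occupied (_ ∷ occ) (suc s) {zero}  eq = eq
fill-occupied (_ ∷ occ) (suc s) {suc e} eq = fill-occupied occ s eq

occupy-occupied : (occ : Subset n) (s : Maybe (Fin n)) {e : Fin n} →
                  lookup occ e ≡ true → lookup (occupy occ s) e ≡ true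
occupy-occupied occ (just s) eq = fill-occupied occ s eq
occupy-occupied occ nothing  eq = eq

-- Luck of the first spot

-- Cars park only in vacant spots, and an occupied spot never becomes vacant again.
parkAll-avoids-occupied :
  (occ : Subset n) (as : Vec (Fin n) m) {s : Fin n} → lookup occ s ≡ true →
  ∀ i → lookup (parkAll occ as) i ≢ just s
parkAll-avoids-occupied occ (a ∷ as) full zero    parked
  with () ← trans (sym full) (park-vacant occ a parked)
parkAll-avoids-occupied occ (a ∷ as) full (suc i) parked =
  parkAll-avoids-occupied _ as (occupy-occupied occ (park occ a) full) i parked

-- A car preferring the vacant first spot takes it at once and shuts out all later cars; any other
-- car leaves it vacant. With as many vacancies as cars, the cars cannot run out while it is still
-- vacant.
unique-lucky-car :
  (occ : Subset n) (as : Vec (Fin (suc n)) m) →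
  All Is-just (parkAll (false ∷ occ) as) → ∣ ∁ (false ∷ occ) ∣ ≡ m →
  ∃! _≡_ (λ i → lookup (parkAll (false ∷ occ) as) i ≡ just zero × lookup as i ≡ zero)
unique-lucky-car occ (zero  ∷ as) _ _ = zero , (refl , refl) , λ
  { {zero}  _            → refl
  ; {suc i} (parked , _) → contradiction parked (parkAll-avoids-occupied (true ∷ occ) as refl i) }
unique-lucky-car occ (suc a ∷ as) (_ ∷ all) vac with park occ a in eq
... | just s with i , lucky , unique ← unique-lucky-car (occ [ s ]≔ true) as all
                    (trans (sym (vacancies-fill occ s (park-vacant occ a eq))) (suc-injective vac))
    = suc i , lucky , λ { {suc j} → cong suc ∘ unique }

unique-lucky-parking :
  ∀ n (as : Preferences (suc n)) → IsParkingFunction as →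
  ∃! _≡_ (λ i → lookup (spots as) i ≡ just zero × lookup as i ≡ zero)
unique-lucky-parking n as pf = unique-lucky-car ∅ as pf (vacancies-∅ (suc n))

#parking : ℕ → ℕ
#parking n = count IsParkingFunction (isParkingFunction? {n})

#luckySpot-first : ∀ n → #luckySpot (suc n) zero ≡ #parking (suc n)
#luckySpot-first n = cong length (filter-≐ _ _
  (proj₁ , λ {as} pf → pf , (let i , lucky , _ = unique-lucky-parking n as pf in i , lucky))
  (allVecs (suc n) (suc n)))

∑-q-first : ∀ n → ∑[ i < suc n ] q (suc n) i zero ≡ #parking (suc n)
∑-q-first n = ∑-length-filter
  (λ i as → isParkingFunction? as ×-dec (lookup as i ≟ zero) ×-dec luckyCar? as i)
  isParkingFunction? proj₁
  (λ {as} pf →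
    -- Given that car `i` prefers the first spot, `LuckyCar as i` says that it parks there.
    let i , (parked , pref) , unique = unique-lucky-parking n as pf in
    i , (pf , pref , trans parked (cong just (sym pref))) ,
    λ (_ , pref′ , lucky) → unique (trans lucky (cong just pref′) , pref′))
  (allVecs (suc n) (suc n))

-- Circular parking

-- When `park` runs off the end, the search resumes at `zero`; the result is `nothing` only on a
-- full circle.
circlePark : Subset n → Fin n → Maybe (Fin n)
circlePark occ a = park occ a <∣> firstAvailable occ

-- The number of sequences of m cars after which spot e is empty.
leaving : ℕ → Subset n → Fin n → ℕ
leaving         zero    occ e = if lookup occ e then 0 else 1
leaving {n = n} (suc m) occ e = ∑[ a < n ] leaving m (occupy occ (circlePark occ a)) e

leaving-occupied : ∀ m (occ : Subset n) {e : Fin n} → lookup occ e ≡ true → leaving m occ e ≡ 0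
leaving-occupied zero    occ full rewrite full = refl
leaving-occupied (suc m) occ full =
  sum-zero λ a → leaving-occupied m _ (occupy-occupied occ (circlePark occ a) full)

circlePark-vacancies : (occ : Subset n) (a : Fin n) → ∣ ∁ occ ∣ ≡ suc k →
                       ∣ ∁ (occupy occ (circlePark occ a)) ∣ ≡ k
circlePark-vacancies occ a vac with park occ a in eq
... | just s = suc-injective (trans (sym (vacancies-fill occ s (park-vacant occ a eq))) vac)
... | nothing with firstAvailable occ in eq′
...   | just s  = suc-injective (trans (sym (vacancies-fill occ s (firstAvailable-vacant occ eq′))) vac)
...   | nothing with () ← trans (sym (firstAvailable-full occ eq′)) vac

-- Each of the `n ^ m` sequences ends with exactly `k` vacant spots, so it is counted once for each
-- of them.
∑-leaving : ∀ m (occ : Subset n) → ∣ ∁ occ ∣ ≡ m + k → ∑[ e < n ] leaving m occ e ≡ n ^ m * k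
∑-leaving         zero    occ vac = trans (∑-vacant occ) (trans vac (sym (+-comm _ 0)))
∑-leaving {n} {k} (suc m) occ vac = begin
  ∑[ e < n ] ∑[ a < n ] leaving m (occupy occ (circlePark occ a)) e
    ≡⟨ ∑-comm (λ e a → leaving m (occupy occ (circlePark occ a)) e) ⟩
  ∑[ a < n ] ∑[ e < n ] leaving m (occupy occ (circlePark occ a)) e
    ≡⟨ sum-cong-≗ (λ a → ∑-leaving m (occupy occ (circlePark occ a)) (circlePark-vacancies occ a vac)) ⟩
  ∑[ a < n ] (n ^ m * k)
    ≡⟨ sum-const n (n ^ m * k) ⟩
  n * (n ^ m * k)
    ≡⟨ *-assoc n (n ^ m) k ⟨
  n ^ suc m * k ∎

-- The added spot is zero; a car that fails to park on the line takes it.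
leaving-zero : ∀ m (occ : Subset n) →
  leaving m (false ∷ occ) zero ≡
  length (filter (λ as → all? (MaybeAny.dec (λ _ → yes tt)) (parkAll occ as)) (allVecs n m))
leaving-zero         zero    occ = refl
leaving-zero {n = n} (suc m) occ = begin
  leaving m (true ∷ occ) zero +
  ∑[ a < n ] leaving m (occupy (false ∷ occ) (circlePark (false ∷ occ) (suc a))) zero
    -- The first summand vanishes: a car preferring the added spot occupies it at once.
    ≡⟨ cong₂ _+_ (leaving-occupied m (true ∷ occ) refl) (sum-cong-≗ step) ⟩
  ∑[ a < n ] length (filter (allPark? ∘ (a ∷_)) (allVecs n m))
    ≡⟨ length-filter-allVecs n m allPark? ⟨
  length (filter allPark? (allVecs n (suc m))) ∎
  where
  allPark? : Decidable {A = Vec (Fin n) (suc m)} (λ as → All Is-just (parkAll occ as))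
  allPark? as = all? (MaybeAny.dec (λ _ → yes tt)) (parkAll occ as)

  step : ∀ a → leaving m (occupy (false ∷ occ) (circlePark (false ∷ occ) (suc a))) zero ≡
               length (filter (allPark? ∘ (a ∷_)) (allVecs n m))
  step a with park occ a
  ... | just s = trans (leaving-zero m (occ [ s ]≔ true))
    (cong length (filter-≐ _ _ ((MaybeAny.just tt ∷_) , λ { (_ ∷ all) → all }) (allVecs n m)))
  -- Both sides are zero: the car wraps around into the added spot, and on the line it fails to
  -- park.
  ... | nothing = trans (leaving-occupied m (true ∷ occ) refl)
    (sym (cong length (filter-none _ {xs = allVecs n m} (ListAll.universal (λ { _ (() ∷ _) }) _))))

-- Rotation

rotate : Vec A (suc n) → Vec A (suc n)
rotate (x ∷ xs) = xs ∷ʳ x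

-- The cyclic predecessor: where `rotate` moves the entry at a given index.
shift : Fin (suc n) → Fin (suc n)
shift {n = n} zero = fromℕ n
shift (suc i)      = inject₁ i

-- `shift` permutes the indices; the right side unfolds to the last term plus all the others.
∑-shift : (f : Fin (suc n) → ℕ) → sum f ≡ ∑[ i < suc n ] f (shift i)
∑-shift {n = n} f = trans (sum-init-last f) (+-comm (sum (f ∘ inject₁)) (f (fromℕ n)))

lookup-∷ʳ-inject₁ : (xs : Vec A n) {x : A} (i : Fin n) → lookup (xs ∷ʳ x) (inject₁ i) ≡ lookup xs i
lookup-∷ʳ-inject₁ (_ ∷ xs) zero    = refl
lookup-∷ʳ-inject₁ (_ ∷ xs) (suc i) = lookup-∷ʳ-inject₁ xs i

lookup-∷ʳ-fromℕ : (xs : Vec A n) {x : A} → lookup (xs ∷ʳ x) (fromℕ n) ≡ x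
lookup-∷ʳ-fromℕ []       = refl
lookup-∷ʳ-fromℕ (_ ∷ xs) = lookup-∷ʳ-fromℕ xs

lookup-rotate : (xs : Vec A (suc n)) (i : Fin (suc n)) → lookup (rotate xs) (shift i) ≡ lookup xs i
lookup-rotate (x ∷ xs) zero    = lookup-∷ʳ-fromℕ xs
lookup-rotate (x ∷ xs) (suc i) = lookup-∷ʳ-inject₁ xs i

∷ʳ-[inject₁]≔ : (xs : Vec A n) {x y : A} (i : Fin n) →
                (xs ∷ʳ x) [ inject₁ i ]≔ y ≡ (xs [ i ]≔ y) ∷ʳ x
∷ʳ-[inject₁]≔ (_ ∷ xs) zero    = refl
∷ʳ-[inject₁]≔ (_ ∷ xs) (suc i) = cong (_ ∷_) (∷ʳ-[inject₁]≔ xs i)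

∷ʳ-[fromℕ]≔ : (xs : Vec A n) {x y : A} → (xs ∷ʳ x) [ fromℕ n ]≔ y ≡ xs ∷ʳ y
∷ʳ-[fromℕ]≔ []       = refl
∷ʳ-[fromℕ]≔ (_ ∷ xs) = cong (_ ∷_) (∷ʳ-[fromℕ]≔ xs)

occupy-rotate : (occ : Subset (suc n)) (s : Maybe (Fin (suc n))) →
                occupy (rotate occ) (Maybe.map shift s) ≡ rotate (occupy occ s)
occupy-rotate (x ∷ occ) (just zero)    = ∷ʳ-[fromℕ]≔ occ
occupy-rotate (x ∷ occ) (just (suc s)) = ∷ʳ-[inject₁]≔ occ s
occupy-rotate (x ∷ occ) nothing        = refl

rotate-∅ : ∀ n → rotate (∅ {suc n}) ≡ ∅
rotate-∅ zero    = refl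
rotate-∅ (suc n) = cong (false ∷_) (rotate-∅ n)

-- Rotation puts the old first spot last, where a linear search reaches it only as a last resort.
-- Together with the two `park` lemmas below, this reduces searches after a rotation to searches on
-- the tail.
firstAvailable-∷ʳ : (occ : Subset n) (x : Bool) →
  firstAvailable (occ ∷ʳ x) ≡
  Maybe.map inject₁ (firstAvailable occ) <∣> (if x then nothing else just (fromℕ n))
firstAvailable-∷ʳ []            false = refl
firstAvailable-∷ʳ []            true  = refl
firstAvailable-∷ʳ (false ∷ occ) x     = refl
firstAvailable-∷ʳ (true  ∷ occ) x rewrite firstAvailable-∷ʳ occ x
  with firstAvailable occ | x
... | just _  | _     = refl
... | nothing | false = refl
... | nothing | true  = refl

park-∷ʳ-inject₁ : (occ : Subset n) (x : Bool) (a : Fin n) →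
  park (occ ∷ʳ x) (inject₁ a) ≡
  Maybe.map inject₁ (park occ a) <∣> (if x then nothing else just (fromℕ n))
park-∷ʳ-inject₁ (y ∷ occ) x zero    = firstAvailable-∷ʳ (y ∷ occ) x
park-∷ʳ-inject₁ (y ∷ occ) x (suc a) rewrite park-∷ʳ-inject₁ occ x a
  with park occ a | x
... | just _  | _     = refl
... | nothing | false = refl
... | nothing | true  = refl

park-∷ʳ-fromℕ : (occ : Subset n) (x : Bool) →
  park (occ ∷ʳ x) (fromℕ n) ≡ (if x then nothing else just (fromℕ n))
park-∷ʳ-fromℕ []        false = refl
park-∷ʳ-fromℕ []        true  = refl
park-∷ʳ-fromℕ (_ ∷ occ) x rewrite park-∷ʳ-fromℕ occ x with x
... | false = refl
... | true  = refl

-- Rotation only moves the point where the circle is cut, so the same physical spot is found; what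
-- changes is whether it is reached before or after wrapping around.
circlePark-rotate : (occ : Subset (suc n)) (a : Fin (suc n)) →
                    circlePark (rotate occ) (shift a) ≡ Maybe.map shift (circlePark occ a)
circlePark-rotate (false ∷ occ) zero rewrite park-∷ʳ-fromℕ occ false = refl
-- The unrotated car drives on into `occ`; the rotated one starts at the last spot, finds it taken
-- and wraps around into `occ`.
circlePark-rotate (true  ∷ occ) zero
  rewrite park-∷ʳ-fromℕ occ true | firstAvailable-∷ʳ occ true
  with firstAvailable occ
... | just _  = refl
... | nothing = refl
circlePark-rotate (false ∷ occ) (suc a) rewrite park-∷ʳ-inject₁ occ false a
  with park occ a
... | just _  = refl
... | nothing = refl
circlePark-rotate (true  ∷ occ) (suc a)
  rewrite park-∷ʳ-inject₁ occ true a | firstAvailable-∷ʳ occ true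
  with park occ a | firstAvailable occ
... | just _  | _       = refl
... | nothing | just _  = refl
... | nothing | nothing = refl

-- Shifting every preference is a bijection between the sequences counted on the two sides;
-- `∑-shift` applies it one car at a time.
leaving-rotate : ∀ m (occ : Subset (suc n)) (e : Fin (suc n)) →
                 leaving m (rotate occ) (shift e) ≡ leaving m occ e
leaving-rotate zero occ e = cong (if_then 0 else 1) (lookup-rotate occ e)
leaving-rotate {n = n} (suc m) occ e = begin
  ∑[ a < suc n ] leaving m (occupy (rotate occ) (circlePark (rotate occ) a)) (shift e)
    ≡⟨ ∑-shift (λ a → leaving m (occupy (rotate occ) (circlePark (rotate occ) a)) (shift e)) ⟩
  ∑[ a < suc n ] leaving m (occupy (rotate occ) (circlePark (rotate occ) (shift a))) (shift e)
    ≡⟨ sum-cong-≗ (λ a → trans (cong (λ o → leaving m o (shift e)) (rotate-step a))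
                               (leaving-rotate m (occupy occ (circlePark occ a)) e)) ⟩
  ∑[ a < suc n ] leaving m (occupy occ (circlePark occ a)) e ∎
  where
  rotate-step : ∀ a → occupy (rotate occ) (circlePark (rotate occ) (shift a)) ≡
                      rotate (occupy occ (circlePark occ a))
  rotate-step a = trans (cong (occupy (rotate occ)) (circlePark-rotate occ a))
                        (occupy-rotate occ (circlePark occ a))

-- The empty circle is fixed by `rotate`, and `shift (suc i)` is `inject₁ i`, so rotating steps from
-- each spot down to the previous one.
leaving-∅ : ∀ m (e : Fin (suc n)) → leaving m ∅ e ≡ leaving m (∅ {suc n}) zero
leaving-∅ {n = n} m = <-weakInduction (λ e → leaving m ∅ e ≡ leaving m (∅ {suc n}) zero) refl
  λ i ih → trans (sym (leaving-rotate m ∅ (suc i)))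
                 (trans (cong (λ o → leaving m o (inject₁ i)) (rotate-∅ n)) ih)

#parking-formula : ∀ n → #parking (suc n) ≡ suc (suc n) ^ n
-- The cancelled factor is the number of spots on the circle, each left empty equally often.
#parking-formula n = *-cancelˡ-≡ _ _ (suc (suc n)) (begin
  suc (suc n) * #parking (suc n)
    ≡⟨ sum-const (suc (suc n)) (#parking (suc n)) ⟨
  ∑[ e < suc (suc n) ] #parking (suc n)
    ≡⟨ sum-cong-≗ {suc (suc n)} (λ e → trans (leaving-∅ (suc n) e) (leaving-zero (suc n) ∅)) ⟨
  ∑[ e < suc (suc n) ] leaving (suc n) ∅ e
    -- Here `k` is 1: `suc n` cars on `suc (suc n)` spots leave a single vacancy.
    ≡⟨ ∑-leaving (suc n) ∅ (trans (vacancies-∅ (suc (suc n))) (+-comm 1 (suc n))) ⟩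
  suc (suc n) ^ suc n * 1
    ≡⟨ *-identityʳ (suc (suc n) ^ suc n) ⟩
  suc (suc n) ^ suc n ∎)

mainTheorem6 : (n : ℕ) (1≤n : 1 ≤ n) →
    (#luckySpot n (fromℕ< 1≤n) ≡ (∑[ i < n ] q n i (fromℕ< 1≤n)))
    × ((∑[ i < n ] q n i (fromℕ< 1≤n)) ≡ (n + 1) ^ (n ∸ 1))
mainTheorem6 (suc n) _ =
  trans (#luckySpot-first n) (sym (∑-q-first n)) ,
  trans (∑-q-first n) (trans (#parking-formula n) (cong (_^ n) (+-comm 1 (suc n))))
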